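{- Let $k$ be a positive integer. For any prime $p$ and any positive integer $a$, $$O_{p^a}\big(k+p^{\gamma_p(k)+1}m\big)=O_{p^a}(k),$$ where $m\in\mathbb{N}$, $m\neq 0$.
   Context: $O_N(k)$ denotes the multiplicative order of $k$ modulo $N$, i.e. the first positive integer $t$ such that $k^t\equiv 1 \bmod N$. $\nu_p(x)$ is the exponent of the highest power of the prime $p$ dividing $x$. The quantity $\gamma_p(k)$ is defined by $\gamma_p(k)=\nu_p(k^u-1)$ with $u=O_p(k)$ if $p\neq 2$ or $k-1$ is not twice an odd integer, and by $\gamma_2(k)=\nu_2(k^2-1)$ if $p=2$ and $k-1$ is twice an odd integer. Conventions: if $p$ divides no $k^u-1$ with $u\geq 1$, then $\gamma_p(k)=0$; if $k=1$, the quantity $p^{\gamma_p(k)+1}$ is taken to be $0$. -}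

module Defs where

open import Data.Bool.Base using (if_then_else_)
open import Data.Fin.Base using (toℕ)
open import Data.Fin.Properties using (pigeonhole; toℕ<n; toℕ-fromℕ<)
open import Data.Maybe.Base using (Maybe; maybe′; map)
open import Data.Nat
open import Data.Nat.Coprimality using (Coprime; coprime-divisor)
open import Data.Nat.Divisibility
open import Data.Nat.DivMod
open import Data.Nat.Properties
open import Data.Product using (∃; _×_; _,_; proj₁)
open import Data.Sum using (_⊎_; inj₁; inj₂; [_,_]′)
open import Relation.Binary.PropositionalEquality
open import Relation.Nullary
open import Relation.Nullary.Decidable using (dec⇒maybe; does; _×-dec_)
open import Relation.Unary using (Decidable)

Least Greatest : (ℕ → Set) → ℕ → Set
Least    P t = P t × (∀ s → P s → t ≤ s)
Greatest P t = P t × (∀ s → P s → s ≤ t)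

least-below : ∀ {P : ℕ → Set} → Decidable P → ∀ n →
              ∃ (Least P) ⊎ (∀ s → P s → n ≤ s)
least-below P? zero = inj₂ λ _ _ → z≤n
least-below {P} P? (suc n) with least-below P? n
... | inj₁ found = inj₁ found
... | inj₂ none with P? n
...   | yes Pn = inj₁ (n , Pn , none)
...   | no ¬Pn = inj₂ λ s Ps →
          ≤∧≢⇒< (none s Ps) λ n≡s → ¬Pn (subst P (sym n≡s) Ps)

greatest-upto : ∀ {P : ℕ → Set} → Decidable P → ∀ n →
                (∀ s → P s → s ≤ n) → Dec (∃ (Greatest P))
greatest-upto P? n bound with P? n
... | yes Pn = yes (n , Pn , bound)
greatest-upto {P} P? zero bound | no ¬P0 =
  no λ { (s , Ps , _) → ¬P0 (subst P (n≤0⇒n≡0 (bound s Ps)) Ps) }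
greatest-upto {P} P? (suc n) bound | no ¬Pn =
  greatest-upto P? n λ s Ps →
    s≤s⁻¹ (≤∧≢⇒< (bound s Ps) λ s≡n → ¬Pn (subst P s≡n Ps))

infix 4 _≡_[mod_]

_≡_[mod_] : ℕ → ℕ → ℕ → Set
a ≡ b [mod N ] = N ∣ ∣ a - b ∣

IsOrder : (N k t : ℕ) → Set
IsOrder N k = Least λ t → 1 ≤ t × k ^ t ≡ 1 [mod N ]

%-≡⇒mod : ∀ a b N .{{_ : NonZero N}} → a % N ≡ b % N → a ≡ b [mod N ]
%-≡⇒mod a b N eq = divides ∣ a / N - b / N ∣ (begin
  ∣ a - b ∣
    ≡⟨ cong₂ ∣_-_∣ (m≡m%n+[m/n]*n a N)
         (trans (m≡m%n+[m/n]*n b N) (cong (_+ b / N * N) (sym eq))) ⟩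
  ∣ a % N + a / N * N - a % N + b / N * N ∣
    ≡⟨ ∣m+n-m+o∣≡∣n-o∣ (a % N) _ _ ⟩
  ∣ a / N * N - b / N * N ∣
    ≡⟨ *-distribʳ-∣-∣ N (a / N) (b / N) ⟨
  ∣ a / N - b / N ∣ * N ∎)
  where open ≡-Reasoning

∣∧∣-1∣⇒≡1 : ∀ {d} x → d ∣ x → d ∣ ∣ x - 1 ∣ → d ≡ 1
∣∧∣-1∣⇒≡1 zero    _   d∣1 = ∣1⇒≡1 d∣1
∣∧∣-1∣⇒≡1 {d} (suc x) d∣x d∣y =
  ∣1⇒≡1 (∣m+n∣m⇒∣n (subst (d ∣_) (+-comm 1 x) d∣x)
                   (subst (d ∣_) (∣-∣-identityʳ x) d∣y))

unit⇒coprime : ∀ N k t → 1 ≤ t → k ^ t ≡ 1 [mod N ] → Coprime N k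
unit⇒coprime N k (suc t) _ kᵗ≡1 (d∣N , d∣k) =
  ∣∧∣-1∣⇒≡1 (k ^ suc t) (∣m⇒∣m*n (k ^ t) d∣k) (∣-trans d∣N kᵗ≡1)

cancel-^ : ∀ {N k} → Coprime N k → ∀ i {x} → N ∣ k ^ i * x → N ∣ x
cancel-^ {N} c zero    {x} h = subst (N ∣_) (*-identityˡ x) h
cancel-^ {N} {k} c (suc i) {x} h =
  cancel-^ c i (coprime-divisor c (subst (N ∣_) (*-assoc k (k ^ i) x) h))

small-exponent : ∀ N k .{{_ : NonZero N}} → Coprime N k →
                 ∃ λ d → d ≤ N × 1 ≤ d × k ^ d ≡ 1 [mod N ]
small-exponent N k c with pigeonhole (n<1+n N) (λ i → (k ^ toℕ i) mod N)
... | i , j , i<j , eq =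
  d , ≤-trans (m∸n≤m (toℕ j) (toℕ i)) (s≤s⁻¹ (toℕ<n j)) , m<n⇒0<n∸m i<j ,
  cancel-^ c (toℕ i) (subst (N ∣_) factor
    (%-≡⇒mod (k ^ toℕ j) (k ^ toℕ i) N (sym (begin
      k ^ toℕ i % N             ≡⟨ toℕ-fromℕ< _ ⟨
      toℕ ((k ^ toℕ i) mod N)   ≡⟨ cong toℕ eq ⟩
      toℕ ((k ^ toℕ j) mod N)   ≡⟨ toℕ-fromℕ< _ ⟩
      k ^ toℕ j % N             ∎))))
  where
  open ≡-Reasoning
  d = toℕ j ∸ toℕ i
  factor : ∣ k ^ toℕ j - k ^ toℕ i ∣ ≡ k ^ toℕ i * ∣ k ^ d - 1 ∣
  factor = begin
    ∣ k ^ toℕ j - k ^ toℕ i ∣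
      ≡⟨ cong₂ ∣_-_∣ (trans (cong (k ^_) (sym (m+[n∸m]≡n (<⇒≤ i<j))))
                            (^-distribˡ-+-* k (toℕ i) d))
                     (sym (*-identityʳ (k ^ toℕ i))) ⟩
    ∣ k ^ toℕ i * k ^ d - k ^ toℕ i * 1 ∣
      ≡⟨ *-distribˡ-∣-∣ (k ^ toℕ i) (k ^ d) 1 ⟨
    k ^ toℕ i * ∣ k ^ d - 1 ∣ ∎

order? : ∀ N k → Dec (∃ (IsOrder N k))
order? zero k with k ≟ 1
... | yes refl = yes (1 , (≤-refl , ∣-refl) , λ _ → proj₁)
... | no  k≢1  = no λ (t , (1≤t , kᵗ≡1) , _) →
  [ m<n⇒n≢0 1≤t , k≢1 ]′ (m^n≡1⇒n≡0∨m≡1 k t (∣m-n∣≡0⇒m≡n (0∣⇒≡0 kᵗ≡1)))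
order? N@(suc _) k
  with least-below (λ t → (1 ≤? t) ×-dec (N ∣? ∣ k ^ t - 1 ∣)) (suc N)
... | inj₁ found = yes found
... | inj₂ none  = no λ { (t , (1≤t , kᵗ≡1) , _) →
  let d , d≤N , Pd = small-exponent N k (unit⇒coprime N k t 1≤t kᵗ≡1)
  in <⇒≱ (none d Pd) d≤N }

-- `nothing` when no positive power of k is congruent to 1 modulo N, that is,
-- when the multiplicative order is undefined.
O : (N k : ℕ) → Maybe ℕ
O N k = map proj₁ (dec⇒maybe (order? N k))

IsValuation : (p x e : ℕ) → Set
IsValuation p x = Greatest λ e → p ^ e ∣ x

valuation? : ∀ p x → Dec (∃ (IsValuation p x))
valuation? p zero = no λ (e , _ , max) → <-irrefl refl (max (suc e) ((p ^ suc e) ∣0))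
valuation? 0 x@(suc _) = yes (0 , 1∣ x , λ where
  zero    _   → z≤n
  (suc _) 0∣x → contradiction (0∣⇒≡0 0∣x) λ ())
valuation? 1 x@(suc _) = no λ (e , _ , max) →
  <-irrefl refl (max (suc e) (subst (_∣ x) (sym (^-zeroˡ (suc e))) (1∣ x)))
valuation? p@(2+ _) x@(suc _) =
  greatest-upto (λ e → p ^ e ∣? x) x λ e pᵉ∣x → ≤-trans (n≤p^n e) (∣⇒≤ pᵉ∣x)
  where
  n≤p^n : ∀ e → e ≤ p ^ e
  n≤p^n zero    = z≤n
  n≤p^n (suc e) = ≤-<-trans (n≤p^n e)
    (subst (p ^ e <_) (*-comm (p ^ e) p) (m<m*n (p ^ e) p {{m^n≢0 p e}} (s≤s (s≤s z≤n))))

-- For p prime the default value is only reached at x = 0.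
ν : (p x : ℕ) → ℕ
ν p x = maybe′ proj₁ 0 (dec⇒maybe (valuation? p x))

TwiceOdd : ℕ → Set
TwiceOdd n = ∃ λ j → n ≡ 2 * j × ¬ 2 ∣ j

twiceOdd? : ∀ n → Dec (TwiceOdd n)
twiceOdd? n with 2 ∣? n
... | no  2∤n = no λ (j , n≡2j , _) → 2∤n (divides j (trans n≡2j (*-comm 2 j)))
... | yes (divides j refl) with 2 ∣? j
...   | no  2∤j = yes (j , *-comm j 2 , 2∤j)
...   | yes 2∣j = no λ (i , eq , 2∤i) →
          2∤i (subst (2 ∣_) (*-cancelˡ-≡ j i 2 (trans (*-comm 2 j) eq)) 2∣j)

-- Meant for k ≥ 1, where truncated subtraction is ordinary subtraction.  If
-- O p k is undefined, p divides no k ^ u ∸ 1 with u ≥ 1 and the value is 0.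
-- At k = 1 the valuation in question is infinite and γ p k is never used.
γ : (p k : ℕ) → ℕ
γ p k =
  if does (p ≟ 2 ×-dec twiceOdd? (k ∸ 1))
  then ν 2 (k ^ 2 ∸ 1)
  else maybe′ (λ u → ν p (k ^ u ∸ 1)) 0 (O p k)

-- The quantity p ^ (γ p k + 1), read as 0 when k = 1.
p^[γ+1] : (p k : ℕ) → ℕ
p^[γ+1] p k = if does (k ≟ 1) then 0 else p ^ (γ p k + 1)

{-# OPTIONS --safe #-}

-- Let N = p, or N = 4 when p = 2, let u be the order of k modulo N and let
-- c = ν_p (k ^ u − 1), which is γ_p(k).  Lifting the exponent gives
-- p ^ (c + j) ∣ k ^ t − 1 exactly when p ^ j * u ∣ t.  Replacing k by
-- k + p ^ (c + 1) m changes neither u nor c, hence not the condition; and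
-- modulo p ^ a with a ≤ c nothing changes at all.
module Submission where

open import Defs
open import Data.Bool.Base using (if_then_else_)
open import Data.List.Base using (_∷_; [])
open import Data.Maybe.Base using (just; nothing; maybe′)
open import Data.Nat using (ℕ; zero; suc; 2+; _+_; _*_; _^_; _<_; _≤_; _∸_; ∣_-_∣;
  z≤n; s≤s; _≟_; _≤?_; NonZero; >-nonZero; ≢-nonZero; nonTrivial⇒n>1; nonTrivial⇒≢1)
open import Data.Nat.Coprimality using (Coprime)
open import Data.Nat.DivMod using (_%_; _/_; m≡m%n+[m/n]*n; m%n<n)
open import Data.Nat.Divisibility
open import Data.Nat.Primality using (Prime; euclidsLemma; prime⇒irreducible;
  prime⇒nonZero; prime⇒nonTrivial)
open import Data.Nat.Properties
open import Data.Nat.Tactic.RingSolver using (solve)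
open import Data.Product using (∃; ∃₂; _×_; _,_; proj₁; proj₂)
open import Data.Sum using (inj₁; inj₂; [_,_]′)
open import Function using (_∘_; id; _⇔_; mk⇔; Equivalence)
open import Function.Construct.Composition using (_⇔-∘_)
open import Function.Construct.Symmetry using (⇔-sym)
open import Relation.Binary.PropositionalEquality
  using (_≡_; _≢_; refl; sym; trans; cong; subst; subst₂; module ≡-Reasoning)
open import Relation.Nullary using (¬_; Dec; yes; no; contradiction)
open import Relation.Nullary.Decidable using (dec-true; dec-false; _×-dec_)

open Equivalence using (to; from)

private
  variable
    k k' m n t u x y c j p M N : ℕ

∣-resp-≡ : m ≡ n → N ∣ m ⇔ N ∣ n
∣-resp-≡ {N = N} m≡n = mk⇔ (subst (N ∣_) m≡n) (subst (N ∣_) (sym m≡n))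

1+[n∸1]≡n : 0 < n → 1 + (n ∸ 1) ≡ n
1+[n∸1]≡n = m+[n∸m]≡n

∣-+-⇔ : N ∣ n → N ∣ m ⇔ N ∣ m + n
∣-+-⇔ {N} {n} {m} N∣n = mk⇔ (λ N∣m → ∣m∣n⇒∣m+n N∣m N∣n)
  λ N∣m+n → ∣m+n∣m⇒∣n (subst (N ∣_) (+-comm m n) N∣m+n) N∣n

m≤n⇒p^m∣p^n : ∀ p → m ≤ n → p ^ m ∣ p ^ n
m≤n⇒p^m∣p^n {m} {n} p m≤n = divides (p ^ (n ∸ m)) (begin
  p ^ n                ≡⟨ cong (p ^_) (m∸n+n≡m m≤n) ⟨
  p ^ (n ∸ m + m)      ≡⟨ ^-distribˡ-+-* p (n ∸ m) m ⟩
  p ^ (n ∸ m) * p ^ m  ∎)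
  where open ≡-Reasoning

p∣p^n : ∀ p → 1 ≤ n → p ∣ p ^ n
p∣p^n {n} p 1≤n = subst (_∣ p ^ n) (^-identityʳ p) (m≤n⇒p^m∣p^n p 1≤n)

^-pos : 0 < k → ∀ t → 0 < k ^ t
^-pos {k} 0<k = m^n>0 k {{>-nonZero 0<k}}

^-shift : ∀ k M m t → ∃ λ v → (k + M * m) ^ t ≡ k ^ t + M * v
^-shift k M m zero = 0 , sym (cong (1 +_) (*-zeroʳ M))
^-shift k M m (suc t) with v , eq ← ^-shift k M m t =
  k * v + m * (k ^ t + M * v) ,
  trans (cong ((k + M * m) *_) eq) (expand (k ^ t))
  where
  expand : ∀ x → (k + M * m) * (x + M * v) ≡ k * x + M * (k * v + m * (x + M * v))
  expand x = solve (k ∷ M ∷ m ∷ x ∷ v ∷ [])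

^∸1-shift : 0 < k → ∀ M m t → ∃ λ v → (k + M * m) ^ t ∸ 1 ≡ k ^ t ∸ 1 + M * v
^∸1-shift {k} 0<k M m t with v , eq ← ^-shift k M m t =
  v , trans (cong (_∸ 1) eq) (+-∸-comm (M * v) (^-pos 0<k t))

∣^∸1-shift : 0 < k → N ∣ M → ∀ m t → N ∣ k ^ t ∸ 1 ⇔ N ∣ (k + M * m) ^ t ∸ 1
∣^∸1-shift {M = M} 0<k N∣M m t with v , eq ← ^∸1-shift 0<k M m t =
  ⇔-sym (∣-resp-≡ eq) ⇔-∘ ∣-+-⇔ (∣m⇒∣m*n v N∣M)

-- Bridges the absolute difference in the definition of `O` and the truncated subtraction in that of
-- `γ`; they agree because the power is at least 1.
≡1[mod]⇔∣∸1 : 0 < k → ∀ t → k ^ t ≡ 1 [mod N ] ⇔ N ∣ k ^ t ∸ 1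
≡1[mod]⇔∣∸1 0<k t = ∣-resp-≡ (m≤n⇒∣n-m∣≡n∸m (^-pos 0<k t))

-- Writing x as `1 + (x ∸ 1) * 1` makes this the shift lemma at base 1, where `1 ^ n ∸ 1` is 0.
∣x∸1⇒∣x^n∸1 : 0 < x → ∀ n → N ∣ x ∸ 1 → N ∣ x ^ n ∸ 1
∣x∸1⇒∣x^n∸1 {x} {N} 0<x n N∣x∸1 = subst (λ z → N ∣ z ^ n ∸ 1)
  (trans (cong (1 +_) (*-identityʳ (x ∸ 1))) (1+[n∸1]≡n 0<x))
  (to (∣^∸1-shift (s≤s z≤n) N∣x∸1 1 n)
    (subst (λ z → N ∣ z ∸ 1) (sym (^-zeroˡ n)) (N ∣0)))

-- Multiplicative orders.

Least-cong : ∀ {P Q : ℕ → Set} → (∀ s → P s ⇔ Q s) → Least P t → Least Q t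
Least-cong P⇔Q (Pt , least) = to (P⇔Q _) Pt , λ s → least s ∘ from (P⇔Q s)

Least-unique : ∀ {P : ℕ → Set} → Least P m → Least P n → m ≡ n
Least-unique (Pm , m-least) (Pn , n-least) = ≤-antisym (m-least _ Pn) (n-least _ Pm)

IsOrder-cong : (∀ t → k ^ t ≡ 1 [mod N ] ⇔ k' ^ t ≡ 1 [mod N ]) →
               IsOrder N k u → IsOrder N k' u
IsOrder-cong k⇔k' = Least-cong λ t → mk⇔ (λ (1≤t , h) → 1≤t , to (k⇔k' t) h)
                                         (λ (1≤t , h) → 1≤t , from (k⇔k' t) h)

O-just : IsOrder N k u → O N k ≡ just u
O-just {N} {k} ord with order? N k
... | yes (_ , ord') = cong just (Least-unique ord' ord)
... | no  none       = contradiction (_ , ord) none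

O-nothing : ¬ ∃ (IsOrder N k) → O N k ≡ nothing
O-nothing {N} {k} none with order? N k
... | yes found = contradiction found none
... | no  _     = refl

-- The order depends only on the set of exponents that give 1; when it is undefined for one base, it
-- is undefined for the other.
O-cong : (∀ t → k ^ t ≡ 1 [mod N ] ⇔ k' ^ t ≡ 1 [mod N ]) → O N k ≡ O N k'
O-cong {k} {N} k⇔k' with order? N k
... | yes (u , ord) = sym (O-just (IsOrder-cong k⇔k' ord))
... | no  none      = sym (O-nothing λ (u , ord) →
  none (u , IsOrder-cong (⇔-sym ∘ k⇔k') ord))

order-exists : .{{_ : NonZero N}} → Coprime N k → ∃ (IsOrder N k)
order-exists {N} {k} coprime
  with least-below (λ t → (1 ≤? t) ×-dec (N ∣? ∣ k ^ t - 1 ∣)) (suc N)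
     | small-exponent N k coprime
... | inj₁ found | _               = found
... | inj₂ none  | d , d≤N , d-exp = contradiction d≤N (<⇒≱ (none d d-exp))

-- Divide t by u: `k ^ t` and k to the remainder agree modulo N, so a positive remainder would
-- contradict the minimality of u.
order∣exponent : 0 < k → IsOrder N k u → N ∣ k ^ t ∸ 1 → u ∣ t
order∣exponent {k} {N} {u@(suc _)} {t} 0<k ((_ , kᵘ≡1) , minimal) N∣kᵗ∸1
  with t % u in eq
... | zero  = m%n≡0⇒n∣m t u eq
... | suc r = contradiction (minimal (suc r) (s≤s z≤n , from (≡1[mod]⇔∣∸1 0<k (suc r)) N∣kʳ∸1))
                            (<⇒≱ (subst (_< u) eq (m%n<n t u)))
  where
  open ≡-Reasoning
  q = t / u
  Y = (k ^ u) ^ q ∸ 1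
  N∣Y : N ∣ Y
  N∣Y = ∣x∸1⇒∣x^n∸1 (^-pos 0<k u) q (to (≡1[mod]⇔∣∸1 0<k u) kᵘ≡1)
  split : k ^ t ≡ k ^ suc r + Y * k ^ suc r
  split = begin
    k ^ t                            ≡⟨ cong (k ^_) (m≡m%n+[m/n]*n t u) ⟩
    k ^ (t % u + q * u)              ≡⟨ cong (λ z → k ^ (z + q * u)) eq ⟩
    k ^ (suc r + q * u)              ≡⟨ ^-distribˡ-+-* k (suc r) (q * u) ⟩
    k ^ suc r * k ^ (q * u)          ≡⟨ cong (λ z → k ^ suc r * k ^ z) (*-comm q u) ⟩
    k ^ suc r * k ^ (u * q)          ≡⟨ cong (k ^ suc r *_) (^-*-assoc k u q) ⟨
    k ^ suc r * (k ^ u) ^ q          ≡⟨ *-comm (k ^ suc r) _ ⟩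
    (k ^ u) ^ q * k ^ suc r          ≡⟨ cong (_* k ^ suc r) (1+[n∸1]≡n (^-pos (^-pos 0<k u) q)) ⟨
    k ^ suc r + Y * k ^ suc r        ∎
  N∣kʳ∸1 : N ∣ k ^ suc r ∸ 1
  N∣kʳ∸1 = from (∣-+-⇔ (∣m⇒∣m*n _ N∣Y)) (subst (N ∣_)
    (trans (cong (_∸ 1) split) (+-∸-comm _ (^-pos 0<k (suc r)))) N∣kᵗ∸1)

-- Exact prime powers and lifting the exponent.

ExactPower : ℕ → ℕ → ℕ → Set
ExactPower p c y = ∃ λ z → y ≡ p ^ c * z × ¬ p ∣ z

valuation⇒exact : IsValuation p x c → ExactPower p c x
valuation⇒exact {p} {x} {c} (divides z eq , max) = z , trans eq (*-comm z (p ^ c)) ,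
  λ { (divides w refl) → 1+n≰n (max (suc c) (divides w (trans eq (*-assoc w p (p ^ c))))) }

-- The cofactor z becomes `z + p * w`, which p divides only if it divides z.
exact-+ : ExactPower p c y → ∀ w → ExactPower p c (y + p ^ (c + 1) * w)
exact-+ {p} {c} (z , refl , p∤z) w = z + p * w ,
  trans (cong (λ q → p ^ c * z + q * w) (trans (^-distribˡ-+-* p c 1) (cong (p ^ c *_) (*-identityʳ p))))
        (expand (p ^ c)) ,
  p∤z ∘ from (∣-+-⇔ (m∣m*n w))
  where
  expand : ∀ q → q * z + q * p * w ≡ q * (z + p * w)
  expand q = solve (p ∷ q ∷ z ∷ w ∷ [])

-- T is the binomial coefficient n C 2, characterised without division.
binomial₃ : ∀ y n → ∃₂ λ T r → 2 * T + n ≡ n * n ×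
            (1 + y) ^ n ≡ 1 + (n * y + y * (T * y + y * (y * r)))
binomial₃ y zero = 0 , 0 , refl , expand y
  where
  expand : ∀ y → 1 ≡ 1 + y * (0 + y * (y * 0))
  expand y = solve (y ∷ [])
binomial₃ y (suc n) with T , r , triangular , eq ← binomial₃ y n =
  T + n , T + r + y * r ,
  trans (expandT n) (trans (cong (_+ (n + suc n)) triangular) (collectT n)) ,
  trans (cong ((1 + y) *_) eq) (expand n)
  where
  expandT : ∀ n → 2 * (T + n) + (1 + n) ≡ 2 * T + n + (n + (1 + n))
  expandT n = solve (T ∷ n ∷ [])
  collectT : ∀ n → n * n + (n + (1 + n)) ≡ (1 + n) * (1 + n)
  collectT n = solve (n ∷ [])
  expand : ∀ n → (1 + y) * (1 + (n * y + y * (T * y + y * (y * r)))) ≡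
    1 + ((1 + n) * y + y * ((T + n) * y + y * (y * (T + r + y * r))))
  expand n = solve (y ∷ n ∷ T ∷ r ∷ [])

1<prime : Prime p → 1 < p
1<prime {p} prime-p = nonTrivial⇒n>1 p {{prime⇒nonTrivial prime-p}}

-- The identity makes p divide `2 * T`, and a prime other than 2 must then divide T.
prime∣2C : Prime p → p ≢ 2 → ∀ T → 2 * T + p ≡ p * p → p ∣ T
prime∣2C {p} prime-p p≢2 T eq with euclidsLemma 2 T prime-p
  (from (∣-+-⇔ ∣-refl) (subst (p ∣_) (sym eq) (m∣m*n p)))
... | inj₂ p∣T = p∣T
... | inj₁ p∣2 = contradiction
  (≤-antisym (∣⇒≤ p∣2) (1<prime prime-p)) p≢2

-- Beyond `1 + p * y`, the expansion is y times a multiple of `p * p`, so exactly one factor p is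
-- gained. For odd p this rests on p dividing T; for p = 2, where T is 1, it rests on 4 dividing y.
1+y^p : Prime p → p ∣ y → (p ≡ 2 → 4 ∣ y) → ExactPower p c y →
        ∃ λ y' → (1 + y) ^ p ≡ 1 + y' × y ∣ y' × ExactPower p (suc c) y'
1+y^p {p} {y} {c} prime-p p∣y 4∣y (z , y≡pᶜz , p∤z)
  with T , r , triangular , eq ← binomial₃ y p = _ , eq , y∣y' , exact
  where
  p²∣Ty : p * p ∣ T * y
  p²∣Ty with p ≟ 2
  ... | yes refl = ∣n⇒∣m*n T (4∣y refl)
  ... | no  p≢2  = *-pres-∣ (prime∣2C prime-p p≢2 T triangular) p∣y

  y∣y' : y ∣ p * y + y * (T * y + y * (y * r))
  y∣y' = ∣m∣n⇒∣m+n (n∣m*n p) (m∣m*n _)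

  p²∣rest : p * p ∣ T * y + y * (y * r)
  p²∣rest = ∣m∣n⇒∣m+n p²∣Ty (*-pres-∣ p∣y (∣m⇒∣m*n r p∣y))

  exact : ExactPower p (suc c) (p * y + y * (T * y + y * (y * r)))
  exact with divides w rest ← p²∣rest =
    z + p * (z * w) ,
    trans (cong (λ x → p * y + y * x) rest)
      (trans (cong (λ x → p * x + x * (w * (p * p))) y≡pᶜz) (expand (p ^ c))) ,
    p∤z ∘ from (∣-+-⇔ (m∣m*n (z * w)))
    where
    expand : ∀ q → p * (q * z) + q * z * (w * (p * p)) ≡ p * q * (z + p * (z * w))
    expand q = solve (p ∷ q ∷ z ∷ w ∷ [])

-- `(1 + y) ^ s ∸ 1` factors as `y * (s + R)` with R a multiple of p. Cancelling `p ^ c` leaves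
-- `z * (s + R)`, and p does not divide z.
p^[1+c]∣⇒p∣exponent : Prime p → p ∣ y → ExactPower p c y → ∀ s →
                      p ^ suc c ∣ (1 + y) ^ s ∸ 1 → p ∣ s
p^[1+c]∣⇒p∣exponent {p} {y} {c} prime-p p∣y (z , y≡pᶜz , p∤z) s p¹⁺ᶜ∣
  with T , r , _ , eq ← binomial₃ y s = p∣s
  where
  open ≡-Reasoning
  R = T * y + y * (y * r)
  factor : (1 + y) ^ s ∸ 1 ≡ p ^ c * (z * (s + R))
  factor = begin
    (1 + y) ^ s ∸ 1        ≡⟨ cong (_∸ 1) eq ⟩
    s * y + y * R          ≡⟨ cong (_+ y * R) (*-comm s y) ⟩
    y * s + y * R          ≡⟨ *-distribˡ-+ y s R ⟨
    y * (s + R)            ≡⟨ cong (_* (s + R)) y≡pᶜz ⟩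
    p ^ c * z * (s + R)    ≡⟨ *-assoc (p ^ c) z (s + R) ⟩
    p ^ c * (z * (s + R))  ∎

  p∣z*[s+R] : p ∣ z * (s + R)
  p∣z*[s+R] = *-cancelˡ-∣ (p ^ c) {{m^n≢0 p c {{prime⇒nonZero prime-p}}}}
    (subst₂ _∣_ (*-comm p (p ^ c)) factor p¹⁺ᶜ∣)

  p∣s : p ∣ s
  p∣s with euclidsLemma z (s + R) prime-p p∣z*[s+R]
  ... | inj₁ p∣z   = contradiction p∣z p∤z
  ... | inj₂ p∣s+R =
    from (∣-+-⇔ (∣m∣n⇒∣m+n (∣n⇒∣m*n T p∣y) (∣m⇒∣m*n (y * r) p∣y))) p∣s+R

-- Induction on j with y and c varying. Either side forces s to be `q * p`, and `(1 + y) ^ (q * p)`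
-- is `(1 + y') ^ q` with y' exact at `suc c`, so a factor p moves from the exponent into the base.
lifting-the-exponent : Prime p → p ∣ y → (p ≡ 2 → 4 ∣ y) → ExactPower p c y → ∀ j s →
                       p ^ (c + j) ∣ (1 + y) ^ s ∸ 1 ⇔ p ^ j ∣ s
lifting-the-exponent {p} {y} {c} _ _ _ (z , y≡pᶜz , _) zero s =
  mk⇔ (λ _ → 1∣ s) (λ _ → ∣x∸1⇒∣x^n∸1 (s≤s z≤n) s
    (subst₂ _∣_ (cong (p ^_) (sym (+-identityʳ c))) (sym y≡pᶜz) (m∣m*n z)))
lifting-the-exponent {p} {y} {c} prime-p p∣y 4∣y exact (suc j) s
  with y' , eq , y∣y' , exact' ← 1+y^p {c = c} prime-p p∣y 4∣y exact =
  mk⇔ ⇒ ⇐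
  where
  instance _ = prime⇒nonZero prime-p

  step : ∀ q → p ^ (c + suc j) ∣ (1 + y) ^ (q * p) ∸ 1 ⇔ p ^ j ∣ q
  step q = subst₂ (λ e x → p ^ e ∣ x ∸ 1 ⇔ p ^ j ∣ q) (sym (+-suc c j))
    (trans (cong (_^ q) (sym eq))
      (trans (^-*-assoc (1 + y) p q) (cong ((1 + y) ^_) (*-comm p q))))
    (lifting-the-exponent {c = suc c} prime-p (∣-trans p∣y y∣y')
      (λ p≡2 → ∣-trans (4∣y p≡2) y∣y') exact' j q)

  ⇒ : p ^ (c + suc j) ∣ (1 + y) ^ s ∸ 1 → p ^ suc j ∣ s
  ⇒ h with divides q refl ← p^[1+c]∣⇒p∣exponent {c = c} prime-p p∣y exact s
        (∣-trans (m≤n⇒p^m∣p^n p (subst (suc c ≤_) (sym (+-suc c j)) (s≤s (m≤m+n c j)))) h) =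
    subst (p ^ suc j ∣_) (*-comm p q) (*-monoʳ-∣ p (to (step q) h))

  ⇐ : p ^ suc j ∣ s → p ^ (c + suc j) ∣ (1 + y) ^ s ∸ 1
  ⇐ h with divides q refl ← ∣-trans (m∣m*n {p} (p ^ j)) h =
    from (step q) (*-cancelˡ-∣ p (subst (p ^ suc j ∣_) (*-comm q p) h))

-- Data that govern the order modulo every power of p.

-- `p∣N` and `4∣N` give the hypotheses of lifting for `k ^ u ∸ 1`. `N∣pᶜ` hides the shift modulo N,
-- and lets divisibility by `p ^ (c + j)` force u to divide t.
record Frame (p k N u c : ℕ) : Set where
  field
    p∣N   : p ∣ N
    4∣N   : p ≡ 2 → 4 ∣ N
    N∣pᶜ  : N ∣ p ^ c
    order : IsOrder N k u
    exact : ExactPower p c (k ^ u ∸ 1)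

open Frame

-- N divides the shift, so the order modulo N stays; `k ^ u ∸ 1` changes by a multiple of
-- `p ^ (c + 1)`, one power too high to affect exactness at c.
Frame-shift : 0 < k → Frame p k N u c → ∀ m → Frame p (k + p ^ (c + 1) * m) N u c
Frame-shift {k} {p} {N} {u} {c} 0<k F m = record
  { p∣N   = F .p∣N
  ; 4∣N   = F .4∣N
  ; N∣pᶜ  = F .N∣pᶜ
  ; order = IsOrder-cong k⇔k' (F .order)
  ; exact = let w , eq = ^∸1-shift 0<k (p ^ (c + 1)) m u in
            subst (ExactPower p c) (sym eq) (exact-+ {c = c} (F .exact) w)
  }
  where
  k⇔k' : ∀ t → k ^ t ≡ 1 [mod N ] ⇔ (k + p ^ (c + 1) * m) ^ t ≡ 1 [mod N ]
  k⇔k' t = ⇔-sym (≡1[mod]⇔∣∸1 (≤-trans 0<k (m≤m+n k _)) t)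
    ⇔-∘ (∣^∸1-shift 0<k (∣-trans (F .N∣pᶜ) (m≤n⇒p^m∣p^n p (m≤m+n c 1))) m t
    ⇔-∘ ≡1[mod]⇔∣∸1 0<k t)

Frame-∣ : Prime p → 0 < k → Frame p k N u c → ∀ j t →
          p ^ (c + j) ∣ k ^ t ∸ 1 ⇔ p ^ j * u ∣ t
Frame-∣ {p} {k} {N} {u} {c} prime-p 0<k F j t = mk⇔ ⇒ ⇐
  where
  N∣kᵘ∸1 : N ∣ k ^ u ∸ 1
  N∣kᵘ∸1 = to (≡1[mod]⇔∣∸1 0<k u) (F .order .proj₁ .proj₂)

  lte : ∀ s → p ^ (c + j) ∣ k ^ (s * u) ∸ 1 ⇔ p ^ j ∣ s
  lte s = subst (λ x → p ^ (c + j) ∣ x ∸ 1 ⇔ p ^ j ∣ s)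
    (trans (cong (_^ s) (1+[n∸1]≡n (^-pos 0<k u)))
      (trans (^-*-assoc k u s) (cong (k ^_) (*-comm u s))))
    (lifting-the-exponent {c = c} prime-p (∣-trans (F .p∣N) N∣kᵘ∸1)
      (λ p≡2 → ∣-trans (F .4∣N p≡2) N∣kᵘ∸1) (F .exact) j s)

  ⇒ : p ^ (c + j) ∣ k ^ t ∸ 1 → p ^ j * u ∣ t
  ⇒ h with divides s refl ← order∣exponent {t = t} 0<k (F .order)
        (∣-trans (F .N∣pᶜ) (∣-trans (m≤n⇒p^m∣p^n p (m≤m+n c j)) h)) =
    *-monoˡ-∣ u (to (lte s) h)

  ⇐ : p ^ j * u ∣ t → p ^ (c + j) ∣ k ^ t ∸ 1
  ⇐ (divides q refl) = subst (λ e → p ^ (c + j) ∣ k ^ e ∸ 1) (*-assoc q (p ^ j) u)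
    (from (lte (q * p ^ j)) (n∣m*n q))

Frame⇒O≡ : Prime p → 0 < k → Frame p k N u c → ∀ a m →
           O (p ^ a) (k + p ^ (c + 1) * m) ≡ O (p ^ a) k
Frame⇒O≡ {p} {k} {N} {u} {c} prime-p 0<k F a m =
  O-cong λ t → ⇔-sym (≡1[mod]⇔∣∸1 0<k t) ⇔-∘ (k⁺⇔k t ⇔-∘ ≡1[mod]⇔∣∸1 0<k⁺ t)
  where
  k⁺ = k + p ^ (c + 1) * m
  0<k⁺ : 0 < k⁺
  0<k⁺ = ≤-trans 0<k (m≤m+n k _)

  k⁺⇔k : ∀ t → p ^ a ∣ k⁺ ^ t ∸ 1 ⇔ p ^ a ∣ k ^ t ∸ 1
  k⁺⇔k t with ≤-total a c
  ... | inj₁ a≤c = ⇔-sym (∣^∸1-shift 0<k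
    (m≤n⇒p^m∣p^n p (≤-trans a≤c (m≤m+n c 1))) m t)
  -- Both sides amount to `p ^ (a ∸ c) * u ∣ t`, as the two frames share u and c.
  ... | inj₂ c≤a = subst (λ e → p ^ e ∣ k⁺ ^ t ∸ 1 ⇔ p ^ e ∣ k ^ t ∸ 1) (m+[n∸m]≡n c≤a)
    (⇔-sym (Frame-∣ prime-p 0<k F (a ∸ c) t)
      ⇔-∘ Frame-∣ prime-p 0<k⁺ (Frame-shift 0<k F m) (a ∸ c) t)

-- Evaluating `γ` and building frames.

n<p^n : 1 < p → ∀ n → n < p ^ n
n<p^n 1<p zero    = s≤s z≤n
n<p^n {p} 1<p (suc n) = ≤-<-trans (n<p^n 1<p n) (^-monoʳ-< p 1<p (n<1+n n))

-- Excludes the default value of `ν`: without a greatest exponent every power of p would divide x,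
-- even `p ^ x`, which exceeds x.
ν-valuation : 1 < p → x ≢ 0 → IsValuation p x (ν p x)
ν-valuation {p} {x} 1<p x≢0 with valuation? p x
... | yes (_ , val) = val
... | no  none      = contradiction (∣⇒≤ {{≢-nonZero x≢0}} (every-power x)) (<⇒≱ (n<p^n 1<p x))
  where
  every-power : ∀ e → p ^ e ∣ x
  every-power zero = 1∣ x
  every-power (suc e) with p ^ suc e ∣? x
  ... | yes pᵉ⁺¹∣x = pᵉ⁺¹∣x
  ... | no  pᵉ⁺¹∤x = contradiction (e , every-power e , λ s pˢ∣x →
    ≮⇒≥ λ e<s → pᵉ⁺¹∤x (∣-trans (m≤n⇒p^m∣p^n p e<s) pˢ∣x)) none

prime∤⇒coprime : Prime p → ¬ p ∣ k → Coprime p k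
prime∤⇒coprime prime-p p∤k (d∣p , d∣k) =
  [ id , (λ { refl → contradiction d∣k p∤k }) ]′ (prime⇒irreducible prime-p d∣p)

γ-exceptional : TwiceOdd (k ∸ 1) → γ 2 k ≡ ν 2 (k ^ 2 ∸ 1)
γ-exceptional {k} twice-odd =
  cong (if_then ν 2 (k ^ 2 ∸ 1) else maybe′ (λ u → ν 2 (k ^ u ∸ 1)) 0 (O 2 k))
    (dec-true (2 ≟ 2 ×-dec twiceOdd? (k ∸ 1)) (refl , twice-odd))

γ-generic : ¬ (p ≡ 2 × TwiceOdd (k ∸ 1)) → IsOrder p k u → γ p k ≡ ν p (k ^ u ∸ 1)
γ-generic {p} {k} ¬exceptional order-u = trans
  (cong (if_then ν 2 (k ^ 2 ∸ 1) else maybe′ (λ u → ν p (k ^ u ∸ 1)) 0 (O p k))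
    (dec-false (p ≟ 2 ×-dec twiceOdd? (k ∸ 1)) ¬exceptional))
  (cong (maybe′ (λ u → ν p (k ^ u ∸ 1)) 0) (O-just order-u))

k^u∸1≢0 : 1 < k → 1 ≤ u → k ^ u ∸ 1 ≢ 0
k^u∸1≢0 {k} 1<k 1≤u = m<n⇒n≢0 (∸-monoˡ-< (^-monoʳ-< k 1<k 1≤u) ≤-refl)

-- `N∣pᶜ` comes from maximality of the valuation, since `p ^ i` already divides `k ^ u ∸ 1`.
mkFrame : 1 < p → 1 < k → ∀ i → 1 ≤ i → (p ≡ 2 → 2 ≤ i) → IsOrder (p ^ i) k u →
          Frame p k (p ^ i) u (ν p (k ^ u ∸ 1))
mkFrame {p} {k} {u} 1<p 1<k i 1≤i 2≤i order-u@((1≤u , kᵘ≡1) , _) = record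
  { p∣N   = p∣p^n p 1≤i
  ; 4∣N   = λ { refl → m≤n⇒p^m∣p^n 2 (2≤i refl) }
  ; N∣pᶜ  = m≤n⇒p^m∣p^n p (val .proj₂ i (to (≡1[mod]⇔∣∸1 (<⇒≤ 1<k) u) kᵘ≡1))
  ; order = order-u
  ; exact = valuation⇒exact val
  }
  where
  val : IsValuation p (k ^ u ∸ 1) (ν p (k ^ u ∸ 1))
  val = ν-valuation 1<p (k^u∸1≢0 1<k 1≤u)

-- A defined order would make k coprime to `p ^ n`, yet p divides both.
p∣k⇒O≡nothing : Prime p → p ∣ k → 0 < n → O (p ^ n) k ≡ nothing
p∣k⇒O≡nothing {p} {k} {n} prime-p p∣k 0<n = O-nothing λ { (t , (1≤t , kᵗ≡1) , _) →
  nonTrivial⇒≢1 {{prime⇒nonTrivial prime-p}}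
    (unit⇒coprime (p ^ n) k t 1≤t kᵗ≡1
      (p∣p^n p 0<n , p∣k)) }

2∤⇒2∣1+ : ¬ 2 ∣ n → 2 ∣ 1 + n
2∤⇒2∣1+ {n} 2∤n with n % 2 in eq | m%n<n n 2
... | 0    | _             = contradiction (m%n≡0⇒n∣m n 2 eq) 2∤n
... | 1    | _             = divides (1 + n / 2)
  (cong suc (trans (m≡m%n+[m/n]*n n 2) (cong (_+ n / 2 * 2) eq)))
... | 2+ _ | s≤s (s≤s ())

-- Here k is 3 modulo 4, so its order modulo 4 is 2; this explains the square in the exceptional
-- clause of `γ`.
frame-twice-odd : 1 < k → TwiceOdd (k ∸ 1) → Frame 2 k 4 2 (γ 2 k)
frame-twice-odd {k} 1<k twice-odd@(j , k∸1≡2j , 2∤j) =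
  subst (Frame 2 k 4 2) (sym (γ-exceptional {k} twice-odd))
    (mkFrame (s≤s (s≤s z≤n)) 1<k 2 (s≤s z≤n) (λ _ → ≤-refl) ((s≤s z≤n , k²≡1) , minimal))
  where
  0<k : 0 < k
  0<k = <⇒≤ 1<k

  -- The left side is the unfolded form of `(1 + 2 * j) ^ 2`.
  square : ∀ j → (1 + 2 * j) * ((1 + 2 * j) * 1) ≡ 1 + j * (4 * (1 + j))
  square j = solve (j ∷ [])

  k²∸1 : k ^ 2 ∸ 1 ≡ j * (4 * (1 + j))
  k²∸1 = trans (cong (λ x → x ^ 2 ∸ 1) (trans (sym (1+[n∸1]≡n 0<k)) (cong suc k∸1≡2j)))
    (cong (_∸ 1) (square j))

  k²≡1 : k ^ 2 ≡ 1 [mod 4 ]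
  k²≡1 = from (≡1[mod]⇔∣∸1 0<k 2)
    (subst (4 ∣_) (sym k²∸1) (∣n⇒∣m*n j (m∣m*n (1 + j))))

  minimal : ∀ s → 1 ≤ s × k ^ s ≡ 1 [mod 4 ] → 2 ≤ s
  minimal 1 (_ , k≡1) = contradiction (*-cancelˡ-∣ 2 (subst (4 ∣_)
    (trans (cong (_∸ 1) (*-identityʳ k)) k∸1≡2j) (to (≡1[mod]⇔∣∸1 0<k 1) k≡1))) 2∤j
  minimal (2+ _) _ = s≤s (s≤s z≤n)

-- Now 4 divides `k ∸ 1`, so the order is 1 both modulo 2, as `γ` uses it, and modulo 4, as the
-- frame needs it.
frame-¬twice-odd : 1 < k → ¬ 2 ∣ k → ¬ TwiceOdd (k ∸ 1) → Frame 2 k 4 1 (γ 2 k)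
frame-¬twice-odd {k} 1<k 2∤k ¬twice-odd =
  subst (Frame 2 k 4 1)
    (sym (γ-generic (¬twice-odd ∘ proj₂) (order-1 (∣-trans (divides 2 refl) 4∣k∸1))))
    (mkFrame (s≤s (s≤s z≤n)) 1<k 2 (s≤s z≤n) (λ _ → ≤-refl) (order-1 4∣k∸1))
  where
  order-1 : N ∣ k ∸ 1 → IsOrder N k 1
  order-1 {N} N∣k∸1 = (≤-refl , from (≡1[mod]⇔∣∸1 (<⇒≤ 1<k) 1)
    (subst (λ x → N ∣ x ∸ 1) (sym (*-identityʳ k)) N∣k∸1)) , λ _ → proj₁

  2∣k∸1 : 2 ∣ k ∸ 1
  2∣k∸1 = from (∣-+-⇔ ∣-refl) (subst (2 ∣_)
    (trans (cong suc (sym (1+[n∸1]≡n (<⇒≤ 1<k)))) (+-comm 2 (k ∸ 1))) (2∤⇒2∣1+ 2∤k))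

  4∣k∸1 : 4 ∣ k ∸ 1
  4∣k∸1 with divides j k∸1≡j*2 ← 2∣k∸1 with 2 ∣? j
  ... | yes 2∣j = subst (4 ∣_) (sym k∸1≡j*2) (*-monoˡ-∣ 2 2∣j)
  ... | no  2∤j = contradiction (j , trans k∸1≡j*2 (*-comm j 2) , 2∤j) ¬twice-odd

frame-2 : 1 < k → ¬ 2 ∣ k → Dec (TwiceOdd (k ∸ 1)) → ∃₂ λ N u → Frame 2 k N u (γ 2 k)
frame-2 1<k 2∤k (yes twice-odd) = _ , _ , frame-twice-odd 1<k twice-odd
frame-2 1<k 2∤k (no ¬twice-odd) = _ , _ , frame-¬twice-odd 1<k 2∤k ¬twice-odd

frame : Prime p → 1 < k → ¬ p ∣ k → ∃₂ λ N u → Frame p k N u (γ p k)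
frame {p} {k} prime-p 1<k p∤k with p ≟ 2
... | yes refl = frame-2 1<k p∤k (twiceOdd? (k ∸ 1))
... | no  p≢2
  with u , order-u ← order-exists {{prime⇒nonZero prime-p}} (prime∤⇒coprime prime-p p∤k) =
  _ , u , subst (Frame p k (p ^ 1) u) (sym (γ-generic (p≢2 ∘ proj₁) order-u))
    (mkFrame (1<prime prime-p) 1<k 1 ≤-refl (λ p≡2 → contradiction p≡2 p≢2)
      (subst (λ N → IsOrder N k u) (sym (^-identityʳ p)) order-u))

p^[γ+1]-≢1 : k ≢ 1 → p^[γ+1] p k ≡ p ^ (γ p k + 1)
p^[γ+1]-≢1 {k} {p} k≢1 =
  cong (if_then 0 else p ^ (γ p k + 1)) (dec-false (k ≟ 1) k≢1)

theorem3 : ∀ (k : ℕ) → 0 < k →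
    ∀ (p : ℕ) → Prime p → ∀ (a : ℕ) → 0 < a → ∀ (m : ℕ) → m ≢ 0 →
    O (p ^ a) (k + p^[γ+1] p k * m) ≡ O (p ^ a) k
theorem3 k 0<k p prime-p a 0<a m _ with k ≟ 1
-- The shift is 0 by convention, and both sides compute to the same term.
... | yes refl = refl
... | no  k≢1 rewrite p^[γ+1]-≢1 {p = p} k≢1 with p ∣? k
-- The exponent `γ p k + 1` is positive, so p divides the shifted base too and both orders are
-- undefined.
...   | yes p∣k = trans
  (p∣k⇒O≡nothing prime-p (∣m∣n⇒∣m+n p∣k (∣m⇒∣m*n m (p∣p^n p (m≤n+m 1 (γ p k))))) 0<a)
  (sym (p∣k⇒O≡nothing prime-p p∣k 0<a))
...   | no  p∤k with _ , _ , F ← frame prime-p (≤∧≢⇒< 0<k (k≢1 ∘ sym)) p∤k =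
  Frame⇒O≡ prime-p 0<k F a m
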